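{- Let $r \geq 2$, let $H$ be a digraph (possibly with loops), and let $D$ be an $H$-colored $r$-quasi-transitive digraph such that every directed cycle of length $r+1$ in $D$ is an $H$-cycle. For every $k \geq r$, $D$ has a $(k,H)$-kernel.
   Context: All digraphs are finite. A digraph $D$ is $r$-quasi-transitive if for all distinct $u,v\in V(D)$, whenever there is a directed $uv$-path of length $r$, $u$ and $v$ are joined by an arc (in some direction). $D$ has no loops and comes with a map $\rho: A(D)\to V(H)$. For a walk $W=(x_0,\ldots,x_n)$ in $D$, there is an obstruction on $x_i$ if $(\rho(x_{i-1},x_i),\rho(x_i,x_{i+1})) \notin A(H)$; for an open walk this is considered at internal vertices $x_i$, $1\le i\le n-1$, for a closed walk at all $i\in\{0,\ldots,n-1\}$ with indices modulo $n$. $O_H(W)$ is the set of indices with an obstruction; the $H$-length is $l_H(W)=|O_H(W)|+1$ for open $W$ and $|O_H(W)|$ for closed $W$. An $H$-cycle is a directed cycle with no obstructions. A $(k,H)$-kernel ($k\ge2$) is a set $S\subseteq V(D)$ such that for every two distinct $u,v\in S$ every directed $uv$-path in $D$ has $H$-length at least $k$, and for every $x\in V(D)\setminus S$ there is a directed path from $x$ to a vertex of $S$ of $H$-length at most $k-1$. -}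

module Defs where

open import Data.Bool using (Bool; true; false; not; _∧_; T)
open import Data.Fin using (Fin; zero; suc; inject₁; fromℕ)
open import Data.Fin.Subset using (Subset; _∈_; _∉_; ∣_∣; Empty)
open import Data.Nat using (ℕ; suc; _+_; _∸_; _≤_)
open import Data.Product using (∃-syntax; _×_)
open import Data.Sum using (_⊎_)
open import Data.Vec using (tabulate)
open import Function.Base using (_∘_)
open import Function.Definitions using (Injective)
open import Relation.Binary.PropositionalEquality using (_≡_; _≢_)
open import Relation.Nullary using (¬_)

-- Finite digraphs, with loops allowed.  The adjacency is Boolean, so there is
-- at most one arc from u to v, and u ⟶ v has at most one proof.

record Digraph : Set where
  field
    order : ℕ
    arc   : Fin order → Fin order → Bool

  Vertex : Set
  Vertex = Fin order

  _⟶_ : Vertex → Vertex → Set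
  u ⟶ v = T (arc u v)

open Digraph using (Vertex)

module _ (D : Digraph) where
  open Digraph D using (_⟶_)

  Loopless : Set
  Loopless = ∀ u → ¬ (u ⟶ u)

  -- A walk (x₀, …, xₙ) of length n; step i is the arc (xᵢ , xᵢ₊₁).

  record Walk (n : ℕ) : Set where
    field
      vertex : Fin (suc n) → Vertex D
      step   : ∀ i → vertex (inject₁ i) ⟶ vertex (suc i)

    source target : Vertex D
    source = vertex zero
    target = vertex (fromℕ n)

  record Path (u v : Vertex D) (n : ℕ) : Set where
    field
      walk     : Walk n
    open Walk walk public
    field
      source≡  : source ≡ u
      target≡  : target ≡ v
      distinct : Injective _≡_ _≡_ vertex

  -- A cycle of length n is a closed walk (x₀, …, xₙ) with x₀, …, xₙ₋₁ distinct.

  record Cycle (n : ℕ) : Set where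
    field
      walk     : Walk n
    open Walk walk public
    field
      closed   : source ≡ target
      distinct : Injective _≡_ _≡_ (vertex ∘ inject₁)

  QuasiTransitive : ℕ → Set
  QuasiTransitive r = ∀ u v → u ≢ v → Path u v r → (u ⟶ v) ⊎ (v ⟶ u)

record HColoredDigraph (H : Digraph) : Set where
  field
    digraph  : Digraph
    loopless : Loopless digraph
  open Digraph digraph public using (order; _⟶_)
  field
    ρ : ∀ {u v} → u ⟶ v → Vertex H

-- i ↦ i − 1 modulo n

prev : ∀ {n} → Fin n → Fin n
prev {suc n} zero    = fromℕ n
prev         (suc i) = inject₁ i

isPositive : ∀ {n} → Fin n → Bool
isPositive zero    = false
isPositive (suc _) = true

module _ {H : Digraph} (D : HColoredDigraph H) where
  open HColoredDigraph D using (digraph; order; ρ)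

  module _ {n : ℕ} (W : Walk digraph n) where
    open Walk W using (step)

    -- For i = 0 this is an obstruction only if W is closed: it then compares
    -- the last arc of W with the first.

    obstructionAt : Fin n → Bool
    obstructionAt i = not (Digraph.arc H (ρ (step (prev i))) (ρ (step i)))

    closedObstructions : Subset n
    closedObstructions = tabulate obstructionAt

    -- Among the indices below n, the internal ones are 1, …, n − 1.

    openObstructions : Subset n
    openObstructions = tabulate λ i → isPositive i ∧ obstructionAt i

    openHLength : ℕ
    openHLength = ∣ openObstructions ∣ + 1

  IsHCycle : ∀ {n} → Cycle digraph n → Set
  IsHCycle C = Empty (closedObstructions (Cycle.walk C))

  pathHLength : ∀ {u v n} → Path digraph u v n → ℕ
  pathHLength P = openHLength (Path.walk P)

  record IsKernel (k : ℕ) (S : Subset order) : Set where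
    field
      independent : ∀ {u v} → u ∈ S → v ∈ S → u ≢ v →
                    ∀ {n} (P : Path digraph u v n) → k ≤ pathHLength P
      absorbent   : ∀ {x} → x ∉ S →
                    ∃[ y ] y ∈ S × ∃[ n ] ∃[ P ] pathHLength {x} {y} {n} P ≤ k ∸ 1

{-# OPTIONS --safe #-}

-- In a shortest uv-path of length at least r, every window (xᵢ, …, xᵢ₊ᵣ) is
-- closed by the arc xᵢ₊ᵣ ⟶ xᵢ, since xᵢ ⟶ xᵢ₊ᵣ would be a shortcut.  The
-- resulting (r + 1)-cycles are H-cycles, so the path has no obstruction and
-- H-length 1; a shorter path has H-length at most r − 1 anyway.  Hence
-- reachability already gives a path of H-length at most r − 1 ≤ k − 1, and it
-- is enough to choose one vertex in each terminal strong component.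
module Submission where

open import Defs
open import Data.Bool using (Bool; true; false; _∧_; T; T?)
open import Data.Bool.Properties using (T-irrelevant; T-≡; T-not-≡)
open import Data.Fin as Fin using (Fin; zero; suc; toℕ; fromℕ; fromℕ<; inject₁)
open import Data.Fin.Induction using (spo-wellFounded)
open import Data.Fin.Properties as Fin
  using (toℕ<n; toℕ-fromℕ; toℕ-fromℕ<; toℕ-inject₁; toℕ-injective; any?; injective⇒≤)
open import Data.Fin.Subset using (_∈_; _∉_; ∣_∣; Empty; Nonempty)
open import Data.Fin.Subset.Properties using (nonempty?; Empty-unique; ∣⊥∣≡0; ∣p∣≤n)
open import Data.Nat using (ℕ; zero; suc; _+_; _∸_; _≤_; _<_; s≤s; s≤s⁻¹; z<s)
open import Data.Nat.Induction using (<-wellFounded)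
open import Data.Nat.Properties
open import Data.Product using (∃; ∃-syntax; _×_; _,_; proj₁; proj₂)
open import Data.Sum using (_⊎_; inj₁; inj₂)
open import Data.Vec using (tabulate)
open import Data.Vec.Properties using (lookup∘tabulate; []=⇒lookup; lookup⇒[]=)
open import Function.Base using (_∘_)
open import Function.Bundles using (Equivalence)
open import Induction.WellFounded using (Acc; acc; WellFounded)
open import Relation.Binary.Definitions using (tri<; tri≈; tri>)
open import Relation.Binary.PropositionalEquality
open import Relation.Nullary using (¬_; Dec; yes; no; contradiction)
open import Relation.Nullary.Decidable
  using (isYes; toWitness; fromWitness; ¬?; _×-dec_; _⊎-dec_; map′)

-- Membership in subsets given by a Boolean predicate.

∈-tabulate⁺ : ∀ {n} (f : Fin n → Bool) {i} → T (f i) → i ∈ tabulate f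
∈-tabulate⁺ f {i} fi =
  lookup⇒[]= i _ (trans (lookup∘tabulate f i) (Equivalence.to T-≡ fi))

∈-tabulate⁻ : ∀ {n} (f : Fin n → Bool) {i} → i ∈ tabulate f → T (f i)
∈-tabulate⁻ f {i} i∈ =
  Equivalence.from T-≡ (trans (sym (lookup∘tabulate f i)) ([]=⇒lookup i∈))

InjectiveBelow : ∀ {A : Set} → ℕ → (ℕ → A) → Set
InjectiveBelow n f = ∀ {a b} → a < n → b < n → f a ≡ f b → a ≡ b

-- Directed walks with explicit endpoints, and ways to shorten them.

module _ (D : Digraph) where
  open Digraph D using (Vertex; _⟶_)

  -- Length and endpoints are indices, so that concatenation, cutting and deciding existence go by
  -- structural recursion; vertices may repeat.
  data Chain : ℕ → Vertex → Vertex → Set where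
    []  : ∀ {u} → Chain 0 u u
    _∷_ : ∀ {n u v w} → u ⟶ v → Chain n v w → Chain (suc n) u w

module _ {D : Digraph} where
  open Digraph D using (Vertex; _⟶_; arc; order)

  _++_ : ∀ {m n u v w} → Chain D m u v → Chain D n v w → Chain D (m + n) u w
  []      ++ d = d
  (e ∷ c) ++ d = e ∷ (c ++ d)

  chain? : ∀ n u v → Dec (Chain D n u v)
  chain? zero    u v = map′ (λ { refl → [] }) (λ { [] → refl }) (u Fin.≟ v)
  chain? (suc n) u v =
    map′ (λ { (_ , e , c) → e ∷ c }) (λ { (e ∷ c) → _ , e , c })
      (any? λ w → T? (arc u w) ×-dec chain? n w v)

  -- Positions beyond the end of the chain are sent to its last vertex.
  at : ∀ {n u v} → Chain D n u v → ℕ → Vertex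
  at {u = u} []      _       = u
  at {u = u} (_ ∷ _) zero    = u
  at         (_ ∷ c) (suc i) = at c i

  at-first : ∀ {n u v} (c : Chain D n u v) → at c 0 ≡ u
  at-first []      = refl
  at-first (_ ∷ _) = refl

  at-last : ∀ {n u v} (c : Chain D n u v) → at c n ≡ v
  at-last []      = refl
  at-last (_ ∷ c) = at-last c

  at-step : ∀ {n u v} (c : Chain D n u v) {i} → i < n → at c i ⟶ at c (suc i)
  at-step (e ∷ c) {zero}  _   = subst (_ ⟶_) (sym (at-first c)) e
  at-step (e ∷ c) {suc i} i<n = at-step c (s≤s⁻¹ i<n)

  prefix : ∀ {n u v} (c : Chain D n u v) {i} → i ≤ n → Chain D i u (at c i)
  prefix c       {zero}  _   rewrite at-first c = []
  prefix (e ∷ c) {suc i} i≤n = e ∷ prefix c (s≤s⁻¹ i≤n)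

  suffix : ∀ {n u v} (c : Chain D n u v) {i} → i ≤ n → Chain D (n ∸ i) (at c i) v
  suffix c       {zero}  _   rewrite at-first c = c
  suffix (e ∷ c) {suc i} i≤n = suffix c (s≤s⁻¹ i≤n)

  Shorter : ℕ → Vertex → Vertex → Set
  Shorter n u v = ∃[ m ] m < n × Chain D m u v

  -- Serves two purposes: with `m = 0` it removes the stretch between two equal vertices, with
  -- `m = 1` it replaces a stretch by a single arc.
  shortcut : ∀ {n u v} (c : Chain D n u v) {a b m} → a + m < b → b ≤ n →
             Chain D m (at c a) (at c b) → Shorter n u v
  shortcut {n} c {a} {b} {m} a+m<b b≤n d =
    a + (m + (n ∸ b)) , shorter , prefix c a≤n ++ (d ++ suffix c b≤n)
    where
    open ≤-Reasoning
    a≤n = ≤-trans (m≤m+n a m) (≤-trans (<⇒≤ a+m<b) b≤n)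
    shorter : a + (m + (n ∸ b)) < n
    shorter = begin-strict
      a + (m + (n ∸ b)) ≡⟨ +-assoc a m _ ⟨
      a + m + (n ∸ b)   <⟨ +-monoˡ-< (n ∸ b) a+m<b ⟩
      b + (n ∸ b)       ≡⟨ m+[n∸m]≡n b≤n ⟩
      n                 ∎

  shorter⊎injective : ∀ {n u v} (c : Chain D n u v) →
                      Shorter n u v ⊎ InjectiveBelow (suc n) (at c)
  shorter⊎injective {n} c
    with any? {suc n} (λ i → any? {suc n} λ j →
      i Fin.<? j ×-dec at c (toℕ i) Fin.≟ at c (toℕ j))
  ... | yes (i , j , i<j , eq) =
    inj₁ (shortcut c (subst (_< toℕ j) (sym (+-identityʳ (toℕ i))) i<j) (s≤s⁻¹ (toℕ<n j))
      (subst (Chain D 0 _) eq []))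
  ... | no ¬repeat = inj₂ injective
    where
    ¬equal : ∀ {a b} → a < b → b < suc n → at c a ≢ at c b
    ¬equal {a} {b} a<b b<n eq = ¬repeat
      (fromℕ< a<n , fromℕ< b<n , subst₂ _<_ (sym (toℕ-fromℕ< a<n)) (sym (toℕ-fromℕ< b<n)) a<b ,
        subst₂ (λ x y → at c x ≡ at c y) (sym (toℕ-fromℕ< a<n)) (sym (toℕ-fromℕ< b<n)) eq)
      where a<n = <-trans a<b b<n

    injective : InjectiveBelow (suc n) (at c)
    injective {a} {b} a<n b<n eq with <-cmp a b
    ... | tri< a<b _ _ = contradiction eq (¬equal a<b b<n)
    ... | tri≈ _ a≡b _ = a≡b
    ... | tri> _ _ b<a = contradiction (sym eq) (¬equal b<a a<n)

  -- Walks, paths and cycles from vertex sequences indexed by ℕ.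

  module _ {n : ℕ} (f : ℕ → Vertex) (f-step : ∀ {i} → i < n → f i ⟶ f (suc i)) where

    walk : Walk D n
    walk = record
      { vertex = f ∘ toℕ
      ; step   = λ i → subst (λ a → f a ⟶ f (suc (toℕ i))) (sym (toℕ-inject₁ i)) (f-step (toℕ<n i))
      }

    path : InjectiveBelow (suc n) f → Path D (f 0) (f n) n
    path f-inj = record
      { walk     = walk
      ; source≡  = refl
      ; target≡  = cong f (toℕ-fromℕ n)
      ; distinct = λ {i} {j} eq → toℕ-injective (f-inj (toℕ<n i) (toℕ<n j) eq)
      }

    cycle : f 0 ≡ f n → InjectiveBelow n f → Cycle D n
    cycle f0≡fn f-inj = record
      { walk     = walk
      ; closed   = trans f0≡fn (cong f (sym (toℕ-fromℕ n)))
      ; distinct = λ {i} {j} eq → toℕ-injective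
          (f-inj (toℕ<n i) (toℕ<n j) (subst₂ (λ a b → f a ≡ f b) (toℕ-inject₁ i) (toℕ-inject₁ j) eq))
      }

  fromSteps : ∀ n (f : Fin (suc n) → Vertex) → (∀ i → f (inject₁ i) ⟶ f (suc i)) →
              Chain D n (f zero) (f (fromℕ n))
  fromSteps zero    f s = []
  fromSteps (suc n) f s = s zero ∷ fromSteps n (f ∘ suc) (s ∘ suc)

  path⇒chain : ∀ {n u v} → Path D u v n → Chain D n u v
  path⇒chain P = subst₂ (Chain D _) source≡ target≡ (fromSteps _ vertex step)
    where open Path P

  path-length : ∀ {n u v} → Path D u v n → n < order
  path-length P = injective⇒≤ (Path.distinct P)

-- The vertex q + 1 of a chain of length n lies inside a window of length r.
window : ∀ {q r n} → 2 ≤ r → 2 + q ≤ n → r ≤ n →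
         ∃[ i ] ∃[ t ] t + i ≡ q × 2 + t ≤ r × r + i ≤ n
window {q} {r} {n} 2≤r 2+q≤n r≤n with r + q ≤? n
... | yes r+q≤n = q , 0 , refl , 2≤r , r+q≤n
-- The window starting at `q` would run past the end, so the last window is taken; it starts at
-- `n ∸ r`, no later than `q`.
... | no  r+q≰n = n ∸ r , q ∸ (n ∸ r) , m∸n+n≡m n∸r≤q , 2+t≤r , ≤-reflexive (m+[n∸m]≡n r≤n)
  where
  open ≤-Reasoning
  n∸r≤q : n ∸ r ≤ q
  n∸r≤q = m≤n+o⇒m∸n≤o n r (<⇒≤ (≰⇒> r+q≰n))
  2+t≤r : 2 + (q ∸ (n ∸ r)) ≤ r
  2+t≤r = begin
    2 + (q ∸ (n ∸ r)) ≡⟨ +-∸-assoc 2 n∸r≤q ⟨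
    2 + q ∸ (n ∸ r)   ≤⟨ ∸-monoˡ-≤ (n ∸ r) 2+q≤n ⟩
    n ∸ (n ∸ r)       ≡⟨ m∸[m∸n]≡n r≤n ⟩
    r                 ∎

-- Obstructions and H-length.

module _ {H : Digraph} (D : HColoredDigraph H) where
  open HColoredDigraph D

  private
    Vertex = Digraph.Vertex digraph

  -- Quantifying over the arcs makes this a property of three vertices, which transports along
  -- vertex equalities and passes from a cycle to a path sharing them. Since proofs of `_⟶_` are
  -- unique, checking one pair of arcs suffices.
  Unobstructed : Vertex → Vertex → Vertex → Set
  Unobstructed a b c = ∀ (e : a ⟶ b) (f : b ⟶ c) → T (Digraph.arc H (ρ e) (ρ f))

  module _ {n : ℕ} (W : Walk digraph n) where
    open Walk W

    closedObstructions-empty⁻ : Empty (closedObstructions D W) → ∀ i →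
      T (Digraph.arc H (ρ (step (prev i))) (ρ (step i)))
    closedObstructions-empty⁻ empty i
      with Digraph.arc H (ρ (step (prev i))) (ρ (step i)) in eq
    ... | true  = _
    ... | false = empty (i , ∈-tabulate⁺ (obstructionAt D W) (Equivalence.from T-not-≡ eq))

    openObstructions-empty : Empty (openObstructions D W) → openHLength D W ≡ 1
    openObstructions-empty empty =
      cong (_+ 1) (trans (cong ∣_∣ (Empty-unique empty)) (∣⊥∣≡0 n))

  unobstructed : ∀ {a b c} (e : a ⟶ b) (f : b ⟶ c) →
                 T (Digraph.arc H (ρ e) (ρ f)) → Unobstructed a b c
  unobstructed e f t e′ f′ rewrite T-irrelevant e′ e | T-irrelevant f′ f = t

  Unobstructed-resp : ∀ {a b c a′ b′ c′} → a ≡ a′ → b ≡ b′ → c ≡ c′ →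
                      Unobstructed a b c → Unobstructed a′ b′ c′
  Unobstructed-resp refl refl refl t = t

  module _ {n : ℕ} (f : ℕ → Vertex) (f-step : ∀ {i} → i < suc n → f i ⟶ f (suc i)) where
    open Walk (walk {digraph} f f-step) using (step)

    closedObstructions-empty⇒unobstructed :
      Empty (closedObstructions D (walk f f-step)) →
      ∀ {q} → q < n → Unobstructed (f q) (f (suc q)) (f (suc (suc q)))
    closedObstructions-empty⇒unobstructed empty {q} q<n =
      Unobstructed-resp (cong f (trans (toℕ-inject₁ _) i≡q)) (cong (f ∘ suc) i≡q)
        (cong (λ j → f (suc (suc j))) (toℕ-fromℕ< q<n))
        -- `prev (suc i)` computes to `inject₁ i`, so index `suc i` compares the two arcs meeting at
        -- `f (suc q)`.
        (unobstructed (step (inject₁ i)) (step (suc i))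
          (closedObstructions-empty⁻ (walk f f-step) empty (suc i)))
      where
      i = fromℕ< q<n
      i≡q = trans (toℕ-inject₁ i) (toℕ-fromℕ< q<n)

    unobstructed⇒∉openObstructions : ∀ (i : Fin n) →
      Unobstructed (f (toℕ i)) (f (suc (toℕ i))) (f (suc (suc (toℕ i)))) →
      suc i ∉ openObstructions D (walk f f-step)
    unobstructed⇒∉openObstructions i t i∈ =
      subst T (Equivalence.to T-not-≡ (∈-tabulate⁻ (λ j → isPositive j ∧ obstructionAt D (walk f f-step) j) i∈))
        (Unobstructed-resp (cong f (sym (trans (toℕ-inject₁ _) (toℕ-inject₁ i))))
          (cong (f ∘ suc) (sym (toℕ-inject₁ i))) refl t
          (step (inject₁ i)) (step (suc i)))

  openHLength≤ : ∀ {n} (W : Walk digraph (suc n)) → openHLength D W ≤ suc n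
  openHLength≤ {n} W = ≤-trans (≤-reflexive (+-comm _ 1))
    -- Index 0 is not positive, so the count reduces by computation to the `n` internal vertices.
    (s≤s (∣p∣≤n (tabulate (obstructionAt D W ∘ suc))))

  openHLength≤pred : ∀ {n r} → 2 ≤ r → n < r → (W : Walk digraph n) → openHLength D W ≤ r ∸ 1
  -- A walk of length 0 still has H-length 1, so the bound needs `2 ≤ r` here.
  openHLength≤pred {zero}  2≤r n<r W = ∸-monoˡ-≤ 1 2≤r
  openHLength≤pred {suc n} 2≤r n<r W = ≤-trans (openHLength≤ W) (∸-monoˡ-≤ 1 n<r)

  -- From reachability to paths of small H-length.

  module _ (r : ℕ) (2≤r : 2 ≤ r) (quasiTransitive : QuasiTransitive digraph r)
           (cycles : (C : Cycle digraph (suc r)) → IsHCycle D C) where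

    -- The alternative `Shorter` stands in for the assumption that the chain is shortest. The bound
    -- `2 + t ≤ r` makes position `t + i + 1` internal to the window, so both arcs there lie on the
    -- cycle closed by a backward arc.
    window-unobstructed : ∀ {n u v} (c : Chain digraph n u v) → InjectiveBelow (suc n) (at c) →
      ∀ {i t} → r + i ≤ n → 2 + t ≤ r →
      Shorter n u v ⊎ Unobstructed (at c (t + i)) (at c (suc (t + i))) (at c (suc (suc (t + i))))
    window-unobstructed {n} {u} {v} c c-inj {i} {t} r+i≤n 2+t≤r =
      go (quasiTransitive (g 0) (g r) g0≢gr (path g g-step g-inj))
      where
      g : ℕ → Vertex
      g j = at c (j + i)

      g-step : ∀ {j} → j < r → g j ⟶ g (suc j)
      g-step j<r = at-step c (<-≤-trans (+-monoˡ-< i j<r) r+i≤n)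

      g-inj : InjectiveBelow (suc r) g
      g-inj {a} {b} a≤r b≤r eq = +-cancelʳ-≡ i a b (c-inj (bound a≤r) (bound b≤r) eq)
        where
        bound : ∀ {a} → a < suc r → a + i < suc n
        bound a≤r = s≤s (≤-trans (+-monoˡ-≤ i (s≤s⁻¹ a≤r)) r+i≤n)

      g0≢gr : g 0 ≢ g r
      g0≢gr eq = contradiction (g-inj z<s ≤-refl eq) (<⇒≢ (<-≤-trans z<s 2≤r))

      go : (g 0 ⟶ g r) ⊎ (g r ⟶ g 0) → _
      -- One arc replaces `r` arcs, a strict gain because `2 ≤ r`.
      go (inj₁ e) = inj₁ (shortcut c i+1<r+i r+i≤n (e ∷ []))
        where
        i+1<r+i : i + 1 < r + i
        i+1<r+i = subst (_< r + i) (+-comm 1 i) (+-monoˡ-≤ i 2≤r)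
      -- `h` runs through `g r, g 0, …, g r`, so it closes by `refl`, and position `t` of the window
      -- is position `suc t` of the cycle.
      go (inj₂ e) = inj₂ (closedObstructions-empty⇒unobstructed h h-step
        (cycles (cycle h h-step refl h-inj)) {suc t} 2+t≤r)
        where
        h : ℕ → Vertex
        h zero    = g r
        h (suc j) = g j

        h-step : ∀ {j} → j < suc r → h j ⟶ h (suc j)
        h-step {zero}  _   = e
        h-step {suc j} j<r = g-step (s≤s⁻¹ j<r)

        h-inj : InjectiveBelow (suc r) h
        h-inj {zero}  {zero}  _ _ _  = refl
        h-inj {zero}  {suc b} _ b<r eq =
          contradiction (g-inj ≤-refl (m<n⇒m<1+n (s≤s⁻¹ b<r)) eq) (>⇒≢ (s≤s⁻¹ b<r))
        h-inj {suc a} {zero}  a<r _ eq =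
          contradiction (g-inj (m<n⇒m<1+n (s≤s⁻¹ a<r)) ≤-refl eq) (<⇒≢ (s≤s⁻¹ a<r))
        h-inj {suc a} {suc b} a<r b<r eq =
          cong suc (g-inj (m<n⇒m<1+n (s≤s⁻¹ a<r)) (m<n⇒m<1+n (s≤s⁻¹ b<r)) eq)

    ShortPath : Vertex → Vertex → Set
    ShortPath u v = ∃[ n ] ∃[ P ] pathHLength D {u} {v} {n} P ≤ r ∸ 1

    -- No shortest chain is chosen in advance: a repeated vertex, or an obstruction when `r ≤ n`,
    -- yields a shorter chain, and `chain⇒shortPath` iterates this by induction on the length.
    shorter⊎shortPath : ∀ {n u v} → Chain digraph n u v → Shorter n u v ⊎ ShortPath u v
    shorter⊎shortPath {n} {u} {v} c with shorter⊎injective c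
    ... | inj₁ shorter = inj₁ shorter
    ... | inj₂ c-inj   = go
      where
      W : Walk digraph n
      W = walk (at c) (at-step c)

      shortPath : openHLength D W ≤ r ∸ 1 → ShortPath u v
      shortPath l =
        subst₂ ShortPath (at-first c) (at-last c) (n , path (at c) (at-step c) c-inj , l)

      obstructed⇒shorter : r ≤ n → Nonempty (openObstructions D W) → Shorter n u v
      -- `isPositive` rules out index 0, so the obstruction sits at an internal vertex `suc q`.
      obstructed⇒shorter r≤n (suc q , q∈) with window 2≤r (s≤s (toℕ<n q)) r≤n
      ... | i , t , t+i≡q , 2+t≤r , r+i≤n with window-unobstructed c c-inj r+i≤n 2+t≤r
      ...   | inj₁ shorter = shorter
      ...   | inj₂ s = contradiction q∈
                (unobstructed⇒∉openObstructions (at c) (at-step c) q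
                  (subst (λ p → Unobstructed (at c p) (at c (suc p)) (at c (suc (suc p)))) t+i≡q s))

      go : Shorter n u v ⊎ ShortPath u v
      go with n <? r | nonempty? (openObstructions D W)
      ... | yes n<r | _          = inj₂ (shortPath (openHLength≤pred 2≤r n<r W))
      ... | no  n≮r | yes obstr  = inj₁ (obstructed⇒shorter (≮⇒≥ n≮r) obstr)
      ... | no  _   | no  ¬obstr = inj₂ (shortPath
        (≤-trans (≤-reflexive (openObstructions-empty W ¬obstr)) (∸-monoˡ-≤ 1 2≤r)))

    chain⇒shortPath : ∀ {n u v} → Chain digraph n u v → ShortPath u v
    chain⇒shortPath c = go c (<-wellFounded _)
      where
      go : ∀ {n u v} → Chain digraph n u v → Acc _<_ n → ShortPath u v
      go c (acc rec) with shorter⊎shortPath c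
      ... | inj₁ (_ , m<n , d) = go d (rec m<n)
      ... | inj₂ P = P

-- Least representatives of the terminal classes of a preorder on Fin n.
module TerminalRepresentatives {n : ℕ} (_≲_ : Fin n → Fin n → Set)
  (≲-refl : ∀ {x} → x ≲ x) (≲-trans : ∀ {x y z} → x ≲ y → y ≲ z → x ≲ z)
  (_≲?_ : ∀ x y → Dec (x ≲ y)) where

  -- A step down either leaves the class of `x` for good or stays in it and lowers the index. This
  -- tie-break turns the preorder into a strict order, well-founded on `Fin n`.
  _⊏_ : Fin n → Fin n → Set
  y ⊏ x = x ≲ y × (¬ y ≲ x ⊎ y Fin.< x)

  _⊏?_ : ∀ y x → Dec (y ⊏ x)
  y ⊏? x = (x ≲? y) ×-dec (¬? (y ≲? x) ⊎-dec (y Fin.<? x))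

  ⊏-irrefl : ∀ {x y} → x ≡ y → ¬ x ⊏ y
  ⊏-irrefl refl (x≲x , inj₁ x≴x) = x≴x x≲x
  ⊏-irrefl refl (_   , inj₂ x<x) = <-irrefl refl x<x

  ⊏-trans : ∀ {x y z} → x ⊏ y → y ⊏ z → x ⊏ z
  ⊏-trans (y≲x , inj₁ x≴y) (z≲y , _)        = ≲-trans z≲y y≲x , inj₁ (λ x≲z → x≴y (≲-trans x≲z z≲y))
  ⊏-trans (y≲x , inj₂ _)   (z≲y , inj₁ y≴z) = ≲-trans z≲y y≲x , inj₁ (λ x≲z → y≴z (≲-trans y≲x x≲z))
  ⊏-trans (y≲x , inj₂ x<y) (z≲y , inj₂ y<z) = ≲-trans z≲y y≲x , inj₂ (<-trans x<y y<z)

  ⊏-wellFounded : WellFounded _⊏_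
  ⊏-wellFounded = spo-wellFounded record
    { isEquivalence = isEquivalence
    ; irrefl        = ⊏-irrefl
    ; trans         = ⊏-trans
    ; <-resp-≈      = (λ { refl p → p }) , (λ { refl p → p })
    }

  Minimal : Fin n → Set
  Minimal x = ¬ ∃ λ y → y ⊏ x

  minimal? : ∀ x → Dec (Minimal x)
  minimal? x = ¬? (any? (_⊏? x))

  -- If `y` does not reach back, it lies below `x`; if it does, whichever of two distinct vertices
  -- has the smaller index lies below the other.
  minimal-≲⇒≡ : ∀ {x y} → Minimal x → Minimal y → x ≲ y → x ≡ y
  minimal-≲⇒≡ {x} {y} x-min y-min x≲y with y ≲? x | Fin.<-cmp x y
  ... | no y≴x  | _              = contradiction (y , x≲y , inj₁ y≴x) x-min
  ... | yes y≲x | tri< x<y _ _   = contradiction (x , y≲x , inj₂ x<y) y-min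
  ... | yes _   | tri≈ _ x≡y _   = x≡y
  ... | yes _   | tri> _ _ y<x   = contradiction (y , x≲y , inj₂ y<x) x-min

  minimal-above : ∀ x → ∃[ y ] Minimal y × x ≲ y
  minimal-above x = go x (⊏-wellFounded x)
    where
    go : ∀ x → Acc _⊏_ x → ∃[ y ] Minimal y × x ≲ y
    go x (acc rec) with any? (_⊏? x)
    ... | no  x-min     = x , x-min , ≲-refl
    ... | yes (y , y⊏x) with go y (rec y⊏x)
    ...   | z , z-min , y≲z = z , z-min , ≲-trans (proj₁ y⊏x) y≲z

-- The kernel.

theorem22 : (r : ℕ) → 2 ≤ r →
    (H : Digraph) (D : HColoredDigraph H) →
    QuasiTransitive (HColoredDigraph.digraph D) r →
    ((C : Cycle (HColoredDigraph.digraph D) (suc r)) → IsHCycle D C) →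
    (k : ℕ) → r ≤ k →
    ∃ λ S → IsKernel D k S
theorem22 r 2≤r H D quasiTransitive cycles k r≤k = tabulate (isYes ∘ minimal?) , record
  -- Independence is vacuous: no path joins two distinct chosen vertices.
  { independent = λ u∈S v∈S u≢v P →
      contradiction (minimal-≲⇒≡ (∈S⇒minimal u∈S) (∈S⇒minimal v∈S) (_ , path⇒chain P)) u≢v
  ; absorbent = λ {x} _ → absorbed x
  }
  where
  open HColoredDigraph D

  Reaches : Fin order → Fin order → Set
  Reaches u v = ∃ λ n → Chain digraph n u v

  shortPath : ∀ {u v} → Reaches u v → ShortPath D r 2≤r quasiTransitive cycles u v
  shortPath (_ , c) = chain⇒shortPath D r 2≤r quasiTransitive cycles c

  -- The search over lengths is finite because a reachable vertex is reached by a path, whose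
  -- vertices are distinct and whose length is therefore below `order`.
  reaches? : ∀ u v → Dec (Reaches u v)
  reaches? u v = map′ (λ (i , c) → toℕ i , c) bounded (any? {order} λ i → chain? (toℕ i) u v)
    where
    bounded : Reaches u v → ∃ λ (i : Fin order) → Chain digraph (toℕ i) u v
    bounded uv with shortPath uv
    ... | n , P , _ = fromℕ< (path-length P) ,
      subst (λ m → Chain digraph m u v) (sym (toℕ-fromℕ< (path-length P))) (path⇒chain P)

  open TerminalRepresentatives Reaches (0 , []) (λ (_ , c) (_ , d) → _ , c ++ d) reaches?

  ∈S⇒minimal : ∀ {x} → x ∈ tabulate (isYes ∘ minimal?) → Minimal x
  ∈S⇒minimal {x} x∈S = toWitness {a? = minimal? x} (∈-tabulate⁻ _ x∈S)

  absorbed : ∀ x → ∃[ y ] y ∈ tabulate (isYes ∘ minimal?) ×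
                   ∃[ n ] ∃[ P ] pathHLength D {x} {y} {n} P ≤ k ∸ 1
  absorbed x with minimal-above x
  ... | y , y-min , x≲y with shortPath x≲y
  ...   | n , P , l = y , ∈-tabulate⁺ _ (fromWitness {a? = minimal? y} y-min) , n , P ,
                      ≤-trans l (∸-monoˡ-≤ 1 r≤k)
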